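{- Let $\mathcal{A}$ be a structure for a computable relational language with basic relations $R_i$ of arity $k_i$, and suppose $\mathcal{A}$ is effectively defined in $\mathcal{B}$ with parameters $\bar b$, via formulas defining $D(\bar b)$ and $\pm R_i(\bar b)$. For $\bar c$ in the orbit of $\bar b$ (under $\mathrm{Aut}(\mathcal{B})$), let $\mathcal{A}_{\bar c}$ be the copy of $\mathcal{A}$ defined by the same formulas with parameters $\bar c$ in place of $\bar b$. Suppose that: (1) the orbit of $\bar b$ is defined by a computable $\Sigma_1$ formula $\varphi(\bar u)$; (2) there is a generalized computable $\Sigma_1$ formula $\psi(\bar u,\bar v,\bar x,\bar y)$ such that for all $\bar c,\bar d$ in the orbit of $\bar b$, $\psi(\bar c,\bar d,\bar x,\bar y)$ defines an isomorphism $f_{\bar c,\bar d}$ from $\mathcal{A}_{\bar c}$ onto $\mathcal{A}_{\bar d}$; and (3) the family $(f_{\bar c,\bar d})$ preserves identity and composition, i.e. $f_{\bar c,\bar c}=\mathrm{id}$ and $f_{\bar c,\bar e}=f_{\bar d,\bar e}\circ f_{\bar c,\bar d}$ for all $\bar c,\bar d,\bar e$ in the orbit. Then $\mathcal{A}$ is effectively interpreted in $\mathcal{B}$ without parameters.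
   Context: Languages are computable; structures have universe a subset of $\omega$. For a structure $\mathcal{B}$, a set $R\subseteq\mathcal{B}^{<\omega}$ has a generalized computable $\Sigma_1$ definition (possibly with parameters) if there is a computable sequence $(\varphi_n(x_1,\dots,x_n))_n$ of computable infinitary $\Sigma_1$ formulas such that each $\varphi_n$ defines $R\cap\mathcal{B}^n$. $\mathcal{A}$ is effectively defined in $\mathcal{B}$ with parameters $\bar b$ if there exist $D(\bar b)\subseteq\mathcal{B}^{<\omega}$ and relations $R_i(\bar b)\subseteq D(\bar b)^{k_i}$ with $(D(\bar b),(R_i(\bar b))_i)\cong\mathcal{A}$, such that $D(\bar b)$, each $R_i(\bar b)$ and each complement $D(\bar b)^{k_i}\setminus R_i(\bar b)$ are defined by a uniformly computable sequence of generalized computable $\Sigma_1$ formulas with parameters $\bar b$. $\mathcal{A}$ is effectively interpreted in $\mathcal{B}$ (without parameters) if there are $D\subseteq\mathcal{B}^{<\omega}$, a relation $\sim$ on $D$ and $R_i^*\subseteq D^{k_i}$ with $(D,(R_i^*)_i)/\!\sim\;\cong\mathcal{A}$, and a computable sequence of generalized computable $\Sigma_1$ formulas with no parameters defining $D$, $\sim$, its complement in $D^2$, each $R_i^*$ and its complement in $D^{k_i}$. -}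

module Defs where

open import Level using (Level; _⊔_)
open import Data.Nat using (ℕ; zero; suc; _+_)
open import Data.Fin using (Fin)
open import Data.List using (List; length)
open import Data.Vec using (Vec; []; _∷_; lookup; map; _++_; fromList; head; tail)
open import Data.Vec.Relation.Unary.All using (All)
open import Data.Vec.Relation.Binary.Pointwise.Inductive using (Pointwise)
open import Data.Product using (Σ; _×_; ∃; ∃-syntax)
open import Data.Sum using (_⊎_)
open import Data.Empty using (⊥)
open import Data.Unit using (⊤)
open import Relation.Nullary using (¬_)
open import Relation.Binary.PropositionalEquality using (_≡_)

_↔_ : {a b : Level} → Set a → Set b → Set (a ⊔ b)
P ↔ Q = (P → Q) × (Q → P)

-- Computable relational languages: finitely many or ω-many relation
-- symbols, with an arity function.

data Card : Set where
  fin : ℕ → Card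
  inf : Card

SymSet : Card → Set
SymSet (fin k) = Fin k
SymSet inf     = ℕ

record Lang : Set where
  field
    card : Card
    ar   : SymSet card → ℕ
  Sym : Set
  Sym = SymSet card
open Lang public

-- Structures with universe a subset of ω.

record Str (L : Lang) : Set₁ where
  field
    dom : ℕ → Set
    rel : (s : Sym L) → Vec ℕ (ar L s) → Set
open Str public

-- "Pre-structures": a domain predicate and relations on an arbitrary
-- carrier type T (used for ℕ = ω and for List ℕ = B^{<ω}).

record PStr (L : Lang) (T : Set) : Set₁ where
  field
    pdom : T → Set
    prel : (s : Sym L) → Vec T (ar L s) → Set
open PStr public

asPStr : {L : Lang} → Str L → PStr L ℕ
asPStr A = record { pdom = dom A ; prel = rel A }

IsIsoGraph : {L : Lang} {T T' : Set} → PStr L T → PStr L T' → (T → T' → Set) → Set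
IsIsoGraph {L} S S' G =
    (∀ x y → G x y → pdom S x × pdom S' y)
  × (∀ x → pdom S x → ∃[ y ] G x y)
  × (∀ x y y' → G x y → G x y' → y ≡ y')
  × (∀ x x' y → G x y → G x' y → x ≡ x')
  × (∀ y → pdom S' y → ∃[ x ] G x y)
  × (∀ (s : Sym L) xs ys → Pointwise G xs ys → (prel S s xs ↔ prel S' s ys))

-- H is the graph of a surjective map D → |A| (on S-domain) such that
-- equivalence ∼ is exactly the kernel, and the relations are pulled back:
-- i.e. H induces an isomorphism (pdom S, prel S)/∼ ≅ S'.
IsQuotIsoGraph : {L : Lang} {T T' : Set} → PStr L T → (T → T → Set) → PStr L T'
               → (T → T' → Set) → Set
IsQuotIsoGraph {L} S _∼_ S' H =
    (∀ x y → H x y → pdom S x × pdom S' y)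
  × (∀ x → pdom S x → ∃[ y ] H x y)
  × (∀ x y y' → H x y → H x y' → y ≡ y')
  × (∀ y → pdom S' y → ∃[ x ] H x y)
  × (∀ x x' y y' → H x y → H x' y' → ((x ∼ x') ↔ (y ≡ y')))
  × (∀ (s : Sym L) xs ys → Pointwise H xs ys → (prel S s xs ↔ prel S' s ys))

data QF (L : Lang) (n : ℕ) : Set where
  tt ff : QF L n
  eq    : Fin n → Fin n → QF L n
  atom  : (s : Sym L) → Vec (Fin n) (ar L s) → QF L n
  neg   : QF L n → QF L n
  and   : QF L n → QF L n → QF L n
  or    : QF L n → QF L n → QF L n

record ExF (L : Lang) (n : ℕ) : Set where
  constructor ex
  field
    m    : ℕ
    body : QF L (n + m)

-- computable infinitary Σ₁ formula: a computable (c.e.) disjunction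
-- ⋁_k ∃ȳ θ_k.  "Computable" is read synthetically: an Agda sequence.
Σ₁ : Lang → ℕ → Set
Σ₁ L n = ℕ → ExF L n

module _ {L : Lang} (B : Str L) where

  SatQF : {n : ℕ} → QF L n → Vec ℕ n → Set
  SatQF tt         env = ⊤
  SatQF ff         env = ⊥
  SatQF (eq i j)   env = lookup env i ≡ lookup env j
  SatQF (atom s v) env = rel B s (map (lookup env) v)
  SatQF (neg φ)    env = ¬ SatQF φ env
  SatQF (and φ ψ)  env = SatQF φ env × SatQF ψ env
  SatQF (or φ ψ)   env = SatQF φ env ⊎ SatQF ψ env

  SatEx : {n : ℕ} → ExF L n → Vec ℕ n → Set
  SatEx (ex m θ) env = Σ (Vec ℕ m) λ w → All (dom B) w × SatQF θ (env ++ w)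

  SatΣ₁ : {n : ℕ} → Σ₁ L n → Vec ℕ n → Set
  SatΣ₁ Φ env = ∃[ k ] SatEx (Φ k) env

-- For each tuple of lengths (n₁,…,n_k) there is a
-- Σ₁ formula in p + n₁ + … + n_k free variables (parameters first);
-- the whole family is a (synthetically) computable sequence.

total : {k : ℕ} → Vec ℕ k → ℕ
total []       = 0
total (n ∷ ns) = n + total ns

lens : {k : ℕ} → Vec (List ℕ) k → Vec ℕ k
lens = map length

flatten : {k : ℕ} (xs : Vec (List ℕ) k) → Vec ℕ (total (lens xs))
flatten []       = []
flatten (x ∷ xs) = fromList x ++ flatten xs

GenΣ₁ : Lang → (p k : ℕ) → Set
GenΣ₁ L p k = (ns : Vec ℕ k) → Σ₁ L (p + total ns)

IsTup : {L : Lang} → Str L → List ℕ → Set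
IsTup B x = All (dom B) (fromList x)

module _ {L : Lang} (B : Str L) where

  SatGen : {p k : ℕ} → GenΣ₁ L p k → Vec ℕ p → Vec (List ℕ) k → Set
  SatGen Φ c xs = SatΣ₁ B (Φ (lens xs)) (c ++ flatten xs)

  DefinesGen : {p k : ℕ} → GenΣ₁ L p k → Vec ℕ p → (Vec (List ℕ) k → Set) → Set
  DefinesGen Φ c S = ∀ xs → All (IsTup B) xs →
                       (SatGen Φ c xs ↔ S xs)

  DefinesΣ₁ : {ℓ : Level} {n : ℕ} → Σ₁ L n → (Vec ℕ n → Set ℓ) → Set ℓ
  DefinesΣ₁ φ S = ∀ c → All (dom B) c → (SatΣ₁ B φ c ↔ S c)

  InOrbit : {p : ℕ} → Vec ℕ p → Vec ℕ p → Set₁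
  InOrbit b c = ∃[ G ] (IsIsoGraph (asPStr B) (asPStr B) G × Pointwise G b c)

record DefForms (LA LB : Lang) (p : ℕ) : Set where
  field
    φD  : GenΣ₁ LB p 1
    φR  : (s : Sym LA) → GenΣ₁ LB p (ar LA s)
    φnR : (s : Sym LA) → GenΣ₁ LB p (ar LA s)
open DefForms public

module _ {LA LB : Lang} (B : Str LB) {p : ℕ} (F : DefForms LA LB p) where

  Dc : Vec ℕ p → List ℕ → Set
  Dc c x = IsTup B x × SatGen B (φD F) c (x ∷ [])

  Rc : Vec ℕ p → (s : Sym LA) → Vec (List ℕ) (ar LA s) → Set
  Rc c s xs = All (IsTup B) xs × SatGen B (φR F s) c xs

  Ac : Vec ℕ p → PStr LA (List ℕ)
  Ac c = record { pdom = Dc c ; prel = Rc c }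

  EffDefVia : Str LA → Vec ℕ p → Set₁
  EffDefVia A c =
      (∀ s xs → Rc c s xs → All (Dc c) xs)
    × (∀ s → DefinesGen B (φnR F s) c
                (λ xs → All (Dc c) xs × ¬ Rc c s xs))
    × (∃[ G ] IsIsoGraph (Ac c) (asPStr A) G)

EffInterpreted : {LA LB : Lang} → Str LA → Str LB → Set₁
EffInterpreted {LA} {LB} A B =
  Σ (GenΣ₁ LB 0 1) λ ψD →
  Σ (GenΣ₁ LB 0 2) λ ψ∼ →
  Σ (GenΣ₁ LB 0 2) λ ψ≁ →
  Σ ((s : Sym LA) → GenΣ₁ LB 0 (ar LA s)) λ ψR →
  Σ ((s : Sym LA) → GenΣ₁ LB 0 (ar LA s)) λ ψnR →
  Σ (List ℕ → Set) λ D →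
  Σ (List ℕ → List ℕ → Set) λ _∼_ →
  Σ ((s : Sym LA) → Vec (List ℕ) (ar LA s) → Set) λ R* →
      (∀ x → D x → IsTup B x)
    × (∀ x y → x ∼ y → D x × D y)
    × (∀ s xs → R* s xs → All D xs)
    × DefinesGen B ψD [] (λ xs → D (head xs))
    × DefinesGen B ψ∼ [] (λ xs → D (head xs) × D (head (tail xs))
                                  × (head xs ∼ head (tail xs)))
    × DefinesGen B ψ≁ [] (λ xs → D (head xs) × D (head (tail xs))
                                  × ¬ (head xs ∼ head (tail xs)))
    × (∀ s → DefinesGen B (ψR s) [] (λ xs → All D xs × R* s xs))
    × (∀ s → DefinesGen B (ψnR s) [] (λ xs → All D xs × ¬ R* s xs))
    × (∃[ H ] IsQuotIsoGraph (record { pdom = D ; prel = R* }) _∼_ (asPStr A) H)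

ψGraph : {L : Lang} (B : Str L) {p : ℕ} → GenΣ₁ L (p + p) 2
       → Vec ℕ p → Vec ℕ p → List ℕ → List ℕ → Set
ψGraph B ψ c d x y = IsTup B x × IsTup B y × SatGen B ψ (c ++ d) (x ∷ y ∷ [])

module Submission where

-- Proposition 6.2.  An element of A is represented by a tuple c̄⁀x̄
-- with c̄ in the orbit of b̄ and x̄ ∈ D(c̄); c̄⁀x̄ ∼ d̄⁀ȳ iff
-- f_{c̄,d̄}(x̄) = ȳ; and R* holds of z̄₁…z̄ₖ iff for some c̄ in the orbit
-- the elements represented by the z̄ᵢ in A_c̄ satisfy R(c̄).  The map
-- c̄⁀x̄ ↦ f_{c̄,b̄}(x̄) ∈ A_b̄ ≅ A induces (D,R*)/∼ ≅ A, with ∼ its kernel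
-- by coherence of f.  The complement of R* is defined the same way from
-- the formulas for ¬R, which define ¬R(c̄) for every c̄ in the orbit
-- because Σ₁ satisfaction is invariant under automorphisms of B.

open import Defs
open import Data.Nat using (ℕ; zero; suc; _+_; _∸_; _<_; _≤_; _<?_; _≤?_; z≤n; s≤s)
open import Data.Nat.Properties using (+-suc; +-identityʳ; suc-injective; m+n∸m≡n; m≤m+n)
import Data.Nat.Properties as ℕ
open import Data.Fin using (Fin; fromℕ<; splitAt; _↑ˡ_; _↑ʳ_; toℕ) renaming (zero to fz; suc to fs)
open import Data.Fin.Properties using (all?)
open import Data.List using (List; length) renaming ([] to []L; _∷_ to _∷L_; _++_ to _++L_)
open import Data.List.Properties using (++-assoc; ++-identityʳ; length-++; ∷-injective)
open import Data.Vec as V using (Vec; []; _∷_; lookup; map; _++_; toList; fromList; tabulate)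
open import Data.Vec.Properties using (toList∘fromList; map-∘; map-cong; lookup-splitAt; lookup-++ˡ; lookup-++ʳ; toList-++; length-toList; lookup∘tabulate; tabulate∘lookup; tabulate-cong)
open import Data.Vec.Relation.Unary.All as All using (All; []; _∷_)
open import Data.Vec.Relation.Unary.All.Properties using (++⁺; ++⁻)
open import Data.Vec.Relation.Binary.Pointwise.Inductive as PW using (Pointwise; []; _∷_)
open import Data.Product using (Σ; _×_; _,_; proj₁; proj₂; ∃-syntax)
open import Data.Sum using (_⊎_; inj₁; inj₂; [_,_]′)
open import Data.Empty using (⊥-elim)
open import Data.Unit using (tt)
open import Relation.Nullary using (¬_; yes; no)
open import Relation.Binary.PropositionalEquality using (_≡_; refl; sym; trans; cong; cong₂; subst)

↔-refl : {P : Set} → P ↔ P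
↔-refl = (λ x → x) , (λ x → x)

↔-trans : {P Q R : Set} → P ↔ Q → Q ↔ R → P ↔ R
↔-trans (f , g) (f' , g') = (λ x → f' (f x)) , (λ x → g (g' x))

¬-cong : {P Q : Set} → P ↔ Q → (¬ P) ↔ (¬ Q)
¬-cong (f , g) = (λ n x → n (g x)) , (λ n x → n (f x))

×-cong : {P Q P' Q' : Set} → P ↔ Q → P' ↔ Q' → (P × P') ↔ (Q × Q')
×-cong (f , g) (f' , g') = (λ { (x , y) → f x , f' y }) , (λ { (x , y) → g x , g' y })

⊎-cong : {P Q P' Q' : Set} → P ↔ Q → P' ↔ Q' → (P ⊎ P') ↔ (Q ⊎ Q')
⊎-cong (f , g) (f' , g') = (λ { (inj₁ x) → inj₁ (f x) ; (inj₂ y) → inj₂ (f' y) }) ,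
                           (λ { (inj₁ x) → inj₁ (g x) ; (inj₂ y) → inj₂ (g' y) })

module IsoGraph {L : Lang} {T T' : Set} {S : PStr L T} {S' : PStr L T'} {G : T → T' → Set}
                (iso : IsIsoGraph S S' G) where

  endpoints : ∀ x y → G x y → pdom S x × pdom S' y
  endpoints = proj₁ iso

  defined : ∀ x → pdom S x → ∃[ y ] G x y
  defined = proj₁ (proj₂ iso)

  functional : ∀ x y y' → G x y → G x y' → y ≡ y'
  functional = proj₁ (proj₂ (proj₂ iso))

  injective : ∀ x x' y → G x y → G x' y → x ≡ x'
  injective = proj₁ (proj₂ (proj₂ (proj₂ iso)))

  surjective : ∀ y → pdom S' y → ∃[ x ] G x y
  surjective = proj₁ (proj₂ (proj₂ (proj₂ (proj₂ iso))))

  preserves : ∀ (s : Sym L) xs ys → Pointwise G xs ys → (prel S s xs ↔ prel S' s ys)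
  preserves = proj₂ (proj₂ (proj₂ (proj₂ (proj₂ iso))))

-- An enumeration ℕ → ℕ × ℕ along anti-diagonals, and ℕ → ℕᵏ built
-- from it; both are onto.  They turn a disjunction indexed by pairs
-- (or by k-tuples) into a computable disjunction indexed by ℕ.
nextPair : ℕ × ℕ → ℕ × ℕ
nextPair (a , suc b) = (suc a , b)
nextPair (a , zero)  = (zero , suc a)

unpair : ℕ → ℕ × ℕ
unpair zero    = (zero , zero)
unpair (suc k) = nextPair (unpair k)

unpair-diagonal : ∀ s a b → a + b ≡ s → ∃[ k ] unpair k ≡ (a , b)
unpair-diagonal s zero zero _ = zero , refl
unpair-diagonal s (suc a) b e with unpair-diagonal s a (suc b) (trans (+-suc a b) e)
... | k , h = suc k , cong nextPair h
unpair-diagonal (suc s) zero (suc b) e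
  with unpair-diagonal s b zero (trans (+-identityʳ b) (suc-injective e))
... | k , h = suc k , cong nextPair h

unpair-onto : ∀ a b → ∃[ k ] unpair k ≡ (a , b)
unpair-onto a b = unpair-diagonal (a + b) a b refl

unpairVec : ∀ k → ℕ → Vec ℕ k
unpairVec zero    _ = []
unpairVec (suc k) n = proj₁ (unpair n) ∷ unpairVec k (proj₂ (unpair n))

unpairVec-onto : ∀ {k} (v : Vec ℕ k) → ∃[ n ] unpairVec k n ≡ v
unpairVec-onto [] = zero , refl
unpairVec-onto {suc k} (a ∷ v) with unpairVec-onto v
... | m , h with unpair-onto a m
... | n , e = n , trans (cong (λ q → proj₁ q ∷ unpairVec k (proj₂ q)) e) (cong (a ∷_) h)

module Syntax {L : Lang} (B : Str L) where

  renameQF : ∀ {K n} → (Fin K → Fin n) → QF L K → QF L n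
  renameQF ρ tt         = tt
  renameQF ρ ff         = ff
  renameQF ρ (eq i j)   = eq (ρ i) (ρ j)
  renameQF ρ (atom s v) = atom s (map ρ v)
  renameQF ρ (neg θ)    = neg (renameQF ρ θ)
  renameQF ρ (and θ θ') = and (renameQF ρ θ) (renameQF ρ θ')
  renameQF ρ (or θ θ')  = or (renameQF ρ θ) (renameQF ρ θ')

  record _Renames_to_ {K n} (ρ : Fin K → Fin n) (e : Vec ℕ n) (v : Vec ℕ K) : Set where
    constructor renames
    field at : ∀ i → lookup e (ρ i) ≡ lookup v i
  open _Renames_to_

  renameQF-sat : ∀ {K n} (ρ : Fin K → Fin n) {e : Vec ℕ n} {v : Vec ℕ K} →
                 ρ Renames e to v → ∀ θ → SatQF B (renameQF ρ θ) e ↔ SatQF B θ v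
  renameQF-sat ρ h tt         = ↔-refl
  renameQF-sat ρ h ff         = ↔-refl
  renameQF-sat ρ h (eq i j) rewrite at h i | at h j = ↔-refl
  renameQF-sat ρ {e} {v} h (atom s w) =
    subst (rel B s) atoms , subst (rel B s) (sym atoms)
    where atoms : map (lookup e) (map ρ w) ≡ map (lookup v) w
          atoms = trans (sym (map-∘ (lookup e) ρ w)) (map-cong (at h) w)
  renameQF-sat ρ h (neg θ)    = ¬-cong (renameQF-sat ρ h θ)
  renameQF-sat ρ h (and θ θ') = ×-cong (renameQF-sat ρ h θ) (renameQF-sat ρ h θ')
  renameQF-sat ρ h (or θ θ')  = ⊎-cong (renameQF-sat ρ h θ) (renameQF-sat ρ h θ')

  [_,_]-renames : ∀ {a c n} {e : Vec ℕ n} {u : Vec ℕ a} {w : Vec ℕ c}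
                  {f : Fin a → Fin n} {g : Fin c → Fin n} →
                  f Renames e to u → g Renames e to w →
                  (λ i → [ f , g ]′ (splitAt a i)) Renames e to (u ++ w)
  [_,_]-renames {a} {e = e} {u} {w} {f} {g} hf hg = renames cases
    where
      cases : ∀ i → lookup e ([ f , g ]′ (splitAt a i)) ≡ lookup (u ++ w) i
      cases i rewrite lookup-splitAt a u w i with splitAt a i
      ... | inj₁ x = at hf x
      ... | inj₂ y = at hg y

  ↑ˡ-renames : ∀ {n m} (e : Vec ℕ n) (w : Vec ℕ m) → (_↑ˡ m) Renames (e ++ w) to e
  ↑ˡ-renames e w = renames (lookup-++ˡ e w)

  ↑ʳ-renames : ∀ {n m} (e : Vec ℕ n) (w : Vec ℕ m) → (n ↑ʳ_) Renames (e ++ w) to w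
  ↑ʳ-renames e w = renames (lookup-++ʳ e w)

  liftRen : ∀ {K n} (m : ℕ) → (Fin K → Fin n) → Fin (K + m) → Fin (n + m)
  liftRen {K} {n} m ρ i = [ (λ j → ρ j ↑ˡ m) , (n ↑ʳ_) ]′ (splitAt K i)

  renameEx : ∀ {K n} → (Fin K → Fin n) → ExF L K → ExF L n
  renameEx ρ (ex m θ) = ex m (renameQF (liftRen m ρ) θ)

  renameEx-sat : ∀ {K n} (ρ : Fin K → Fin n) {e : Vec ℕ n} {v : Vec ℕ K} →
                 ρ Renames e to v → ∀ φ → SatEx B (renameEx ρ φ) e ↔ SatEx B φ v
  renameEx-sat ρ {e} {v} h (ex m θ) =
    (λ { (w , aw , s) → w , aw , proj₁ (body w) s }) ,
    (λ { (w , aw , s) → w , aw , proj₂ (body w) s })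
    where
      body : ∀ w → SatQF B (renameQF (liftRen m ρ) θ) (e ++ w) ↔ SatQF B θ (v ++ w)
      body w = renameQF-sat (liftRen m ρ)
                 ([_,_]-renames (renames λ j → trans (lookup-++ˡ e w (ρ j)) (at h j)) (↑ʳ-renames e w)) θ

  private
    module Blocks {n m1 m2 : ℕ} (e : Vec ℕ n) (w : Vec ℕ m1) (u : Vec ℕ m2) where
      first : (λ (k : Fin m1) → n ↑ʳ (k ↑ˡ m2)) Renames (e ++ (w ++ u)) to w
      first = renames λ k → trans (lookup-++ʳ e (w ++ u) (k ↑ˡ m2)) (lookup-++ˡ w u k)

      second : (λ (k : Fin m2) → n ↑ʳ (m1 ↑ʳ k)) Renames (e ++ (w ++ u)) to u
      second = renames λ k → trans (lookup-++ʳ e (w ++ u) (m1 ↑ʳ k)) (lookup-++ʳ w u k)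

  absorbEx : ∀ {n m} → ExF L (n + m) → ExF L n
  absorbEx {n} {m} (ex m' θ) = ex (m + m') (renameQF ρ θ)
    where ρ : Fin ((n + m) + m') → Fin (n + (m + m'))
          ρ i = [ (λ j → [ (_↑ˡ (m + m')) , (λ k → n ↑ʳ (k ↑ˡ m')) ]′ (splitAt n j)) ,
                  (λ j → n ↑ʳ (m ↑ʳ j)) ]′ (splitAt (n + m) i)

  absorbEx-sat : ∀ {n m} (φ : ExF L (n + m)) (e : Vec ℕ n) →
                 SatEx B (absorbEx {n} {m} φ) e ↔
                 (Σ (Vec ℕ m) λ w → All (dom B) w × SatEx B φ (e ++ w))
  absorbEx-sat {n} {m} (ex m' θ) e = fw , bw
    where
      body : ∀ w u → SatQF B (renameQF _ θ) (e ++ (w ++ u)) ↔ SatQF B θ ((e ++ w) ++ u)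
      body w u = renameQF-sat _
        ([_,_]-renames ([_,_]-renames (↑ˡ-renames e (w ++ u)) (Blocks.first e w u))
                       (Blocks.second e w u)) θ
      fw : SatEx B (absorbEx {n} {m} (ex m' θ)) e → _
      fw (wu , awu , s) with V.splitAt m wu
      ... | w , u , refl with ++⁻ w awu
      ... | aw , au = w , aw , u , au , proj₁ (body w u) s
      bw : _ → SatEx B (absorbEx {n} {m} (ex m' θ)) e
      bw (w , aw , u , au , s) = w ++ u , ++⁺ aw au , proj₂ (body w u) s

  conjEx : ∀ {n} → ExF L n → ExF L n → ExF L n
  conjEx {n} (ex m1 θ1) (ex m2 θ2) = ex (m1 + m2) (and (renameQF ρ1 θ1) (renameQF ρ2 θ2))
    where ρ1 : Fin (n + m1) → Fin (n + (m1 + m2))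
          ρ1 i = [ (_↑ˡ (m1 + m2)) , (λ k → n ↑ʳ (k ↑ˡ m2)) ]′ (splitAt n i)
          ρ2 : Fin (n + m2) → Fin (n + (m1 + m2))
          ρ2 i = [ (_↑ˡ (m1 + m2)) , (λ k → n ↑ʳ (m1 ↑ʳ k)) ]′ (splitAt n i)

  conjEx-sat : ∀ {n} (φ ψ : ExF L n) (e : Vec ℕ n) →
               SatEx B (conjEx φ ψ) e ↔ (SatEx B φ e × SatEx B ψ e)
  conjEx-sat {n} (ex m1 θ1) (ex m2 θ2) e = fw , bw
    where
      left : ∀ w u → SatQF B (renameQF _ θ1) (e ++ (w ++ u)) ↔ SatQF B θ1 (e ++ w)
      left w u = renameQF-sat _ ([_,_]-renames (↑ˡ-renames e (w ++ u)) (Blocks.first e w u)) θ1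
      right : ∀ w u → SatQF B (renameQF _ θ2) (e ++ (w ++ u)) ↔ SatQF B θ2 (e ++ u)
      right w u = renameQF-sat _ ([_,_]-renames (↑ˡ-renames e (w ++ u)) (Blocks.second e w u)) θ2
      fw : SatEx B (conjEx (ex m1 θ1) (ex m2 θ2)) e → _
      fw (wu , awu , s1 , s2) with V.splitAt m1 wu
      ... | w , u , refl with ++⁻ w awu
      ... | aw , au = (w , aw , proj₁ (left w u) s1) , (u , au , proj₁ (right w u) s2)
      bw : _ → SatEx B (conjEx (ex m1 θ1) (ex m2 θ2)) e
      bw ((w , aw , s1) , (u , au , s2)) =
        w ++ u , ++⁺ aw au , proj₂ (left w u) s1 , proj₂ (right w u) s2

-- An environment is a list of elements of B; a
-- positional formula refers to entries of the environment by their
-- index.  This is what makes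
-- "generalized" Σ₁ formulas, whose arity depends on the lengths of the
-- tuples plugged in, convenient to write.
module Positional {L : Lang} (B : Str L) where
  open Syntax B

  data At : List ℕ → ℕ → ℕ → Set where
    here  : ∀ {a l} → At (a ∷L l) zero a
    there : ∀ {a l j c} → At l j c → At (a ∷L l) (suc j) c

  At-functional : ∀ {l j a c} → At l j a → At l j c → a ≡ c
  At-functional here      here      = refl
  At-functional (there x) (there y) = At-functional x y

  At-bound : ∀ {l j a} → At l j a → j < length l
  At-bound here      = s≤s z≤n
  At-bound (there x) = s≤s (At-bound x)

  At-exists : ∀ l j → j < length l → ∃[ a ] At l j a
  At-exists (a ∷L l) zero    _       = a , here
  At-exists (a ∷L l) (suc j) (s≤s h) with At-exists l j h
  ... | c , at = c , there at

  At-toList : ∀ {n} (u : Vec ℕ n) (i : Fin n) → At (toList u) (toℕ i) (lookup u i)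
  At-toList (a ∷ u) fz     = here
  At-toList (a ∷ u) (fs i) = there (At-toList u i)

  At-fromℕ< : ∀ {n} (e : Vec ℕ n) j (h : j < n) → At (toList e) j (lookup e (fromℕ< h))
  At-fromℕ< (a ∷ e) zero    h       = here
  At-fromℕ< (a ∷ e) (suc j) (s≤s h) = there (At-fromℕ< e j h)

  At-++ˡ : ∀ {l j a} r → At l j a → At (l ++L r) j a
  At-++ˡ r here      = here
  At-++ˡ r (there x) = there (At-++ˡ r x)

  At-++ʳ : ∀ l {r j a} → At r j a → At (l ++L r) (length l + j) a
  At-++ʳ []L       x = x
  At-++ʳ (_ ∷L l) x = there (At-++ʳ l x)

  record Located {K} (env : List ℕ) (σ : Fin K → ℕ) (u : Vec ℕ K) : Set where
    constructor located
    field places : ∀ i → At env (σ i) (lookup u i)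
  open Located

  Located-functional : ∀ {K env σ} {u u' : Vec ℕ K} → Located env σ u → Located env σ u' → u ≡ u'
  Located-functional {u = u} {u'} l l' =
    trans (sym (tabulate∘lookup u))
          (trans (tabulate-cong (λ i → At-functional (places l i) (places l' i))) (tabulate∘lookup u'))

  data PForm : Set where
    -- a Σ₁ formula whose K variables sit at the positions σ
    emb  : (K : ℕ) → (Fin K → ℕ) → Σ₁ L K → PForm
    _∧ₚ_ : PForm → PForm → PForm
    ⋁ₚ   : (ℕ → PForm) → PForm
    ∃ₚ   : ℕ → PForm → PForm

  SatP : PForm → List ℕ → Set
  SatP (emb K σ Φ) env = Σ (Vec ℕ K) λ u → Located env σ u × SatΣ₁ B Φ u
  SatP (P ∧ₚ Q)    env = SatP P env × SatP Q env
  SatP (⋁ₚ f)      env = ∃[ k ] SatP (f k) env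
  SatP (∃ₚ m P)    env = Σ (Vec ℕ m) λ w → All (dom B) w × SatP P (env ++L toList w)

  emb-sat : ∀ {K env} {σ : Fin K → ℕ} {u : Vec ℕ K} (Φ : Σ₁ L K) →
            Located env σ u → SatP (emb K σ Φ) env ↔ SatΣ₁ B Φ u
  emb-sat Φ l = (λ { (u' , l' , s) → subst (SatΣ₁ B Φ) (Located-functional l' l) s }) ,
                (λ s → _ , l , s)

  falseP : PForm
  falseP = emb zero (λ ()) (λ _ → ex zero ff)

  falseP-unsat : ∀ {env} → ¬ SatP falseP env
  falseP-unsat (_ , _ , _ , _ , _ , ())

  trueP : PForm
  trueP = emb zero (λ ()) (λ _ → ex zero tt)

  trueP-sat : ∀ {env} → SatP trueP env
  trueP-sat = [] , located (λ ()) , zero , [] , [] , tt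

  -- a Σ₁ formula placed at σ, read in an environment of length n;
  -- if some position is out of range, the formula is false
  compileEmb : (n K : ℕ) → (Fin K → ℕ) → Σ₁ L K → Σ₁ L n
  compileEmb n K σ Φ with all? (λ i → σ i <? n)
  ... | yes h = λ k → renameEx (λ i → fromℕ< (h i)) (Φ k)
  ... | no _  = λ _ → ex zero ff

  compile : (n : ℕ) → PForm → Σ₁ L n
  compile n (emb K σ Φ) = compileEmb n K σ Φ
  compile n (P ∧ₚ Q)    = λ k → conjEx (compile n P (proj₁ (unpair k))) (compile n Q (proj₂ (unpair k)))
  compile n (⋁ₚ f)      = λ k → compile n (f (proj₁ (unpair k))) (proj₂ (unpair k))
  compile n (∃ₚ m P)    = λ k → absorbEx {n} {m} (compile (n + m) P k)

  compileEmb-sat : ∀ n K σ Φ (e : Vec ℕ n) →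
                   SatΣ₁ B (compileEmb n K σ Φ) e ↔ SatP (emb K σ Φ) (toList e)
  compileEmb-sat n K σ Φ e with all? (λ i → σ i <? n)
  ... | yes h = fw , bw
    where
      ρ = λ i → fromℕ< (h i)
      u₀ = tabulate (λ i → lookup e (ρ i))
      fw : _
      fw (k , s) = u₀ , located (λ i → subst (At (toList e) (σ i)) (sym (lookup∘tabulate _ i)) (At-fromℕ< e (σ i) (h i))) ,
                   k , proj₁ (renameEx-sat ρ (renames λ i → sym (lookup∘tabulate _ i)) (Φ k)) s
      bw : _
      bw (u , l , k , s) = k , proj₂ (renameEx-sat ρ (renames λ i → At-functional (At-fromℕ< e (σ i) (h i)) (places l i)) (Φ k)) s
  ... | no nh = (λ { (k , w , _ , ()) }) ,
                (λ { (u , l , _) → ⊥-elim (nh (λ i → subst (σ i <_) (length-toList e) (At-bound (places l i)))) })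

  compile-sat : ∀ n P (e : Vec ℕ n) → SatΣ₁ B (compile n P) e ↔ SatP P (toList e)
  compile-sat n (emb K σ Φ) e = compileEmb-sat n K σ Φ e
  compile-sat n (P ∧ₚ Q) e = fw , bw
    where
      fw : _
      fw (k , s) with conjEx-sat (compile n P (proj₁ (unpair k))) (compile n Q (proj₂ (unpair k))) e
      ... | split , _ = proj₁ (compile-sat n P e) (_ , proj₁ (split s)) ,
                        proj₁ (compile-sat n Q e) (_ , proj₂ (split s))
      bw : _
      bw (x , y) with proj₂ (compile-sat n P e) x | proj₂ (compile-sat n Q e) y
      ... | k1 , s1 | k2 , s2 with unpair-onto k1 k2
      ... | k , h = k , subst (λ q → SatEx B (conjEx (compile n P (proj₁ q)) (compile n Q (proj₂ q))) e) (sym h)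
                          (proj₂ (conjEx-sat (compile n P k1) (compile n Q k2) e) (s1 , s2))
  compile-sat n (⋁ₚ f) e = fw , bw
    where
      fw : _
      fw (k , s) = proj₁ (unpair k) , proj₁ (compile-sat n (f (proj₁ (unpair k))) e) (proj₂ (unpair k) , s)
      bw : _
      bw (a , x) with proj₂ (compile-sat n (f a) e) x
      ... | j , s with unpair-onto a j
      ... | k , h = k , subst (λ q → SatEx B (compile n (f (proj₁ q)) (proj₂ q)) e) (sym h) s
  compile-sat n (∃ₚ m P) e = fw , bw
    where
      fw : _
      fw (k , s) with proj₁ (absorbEx-sat {n} {m} (compile (n + m) P k) e) s
      ... | w , aw , s' = w , aw , subst (SatP P) (toList-++ e w) (proj₁ (compile-sat (n + m) P (e ++ w)) (k , s'))
      bw : _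
      bw (w , aw , x) with proj₂ (compile-sat (n + m) P (e ++ w)) (subst (SatP P) (sym (toList-++ e w)) x)
      ... | k , s = k , proj₂ (absorbEx-sat {n} {m} (compile (n + m) P k) e) (w , aw , s)

  -- Quantifying over a k-tuple of finite tuples of B: a disjunction
  -- over the possible lengths (enumerated by unpairVec) of a block ∃.
  ∃Tuples : (k : ℕ) → (Vec ℕ k → PForm) → PForm
  ∃Tuples k P = ⋁ₚ (λ c → ∃ₚ (total (unpairVec k c)) (P (unpairVec k c)))

  private
    IsTup-toList : ∀ {n} {u : Vec ℕ n} → All (dom B) u → IsTup B (toList u)
    IsTup-toList []      = []
    IsTup-toList (x ∷ a) = x ∷ IsTup-toList a

    All-flatten : ∀ {k} {ys : Vec (List ℕ) k} → All (IsTup B) ys → All (dom B) (flatten ys)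
    All-flatten []      = []
    All-flatten (x ∷ a) = ++⁺ x (All-flatten a)

    unflatten : ∀ {k} (ms : Vec ℕ k) → Vec ℕ (total ms) → Vec (List ℕ) k
    unflatten []       _ = []
    unflatten (m ∷ ms) w = toList (proj₁ (V.splitAt m w)) ∷ unflatten ms (proj₁ (proj₂ (V.splitAt m w)))

    unflatten-IsTup : ∀ {k} (ms : Vec ℕ k) (w : Vec ℕ (total ms)) → All (dom B) w →
                      All (IsTup B) (unflatten ms w)
    unflatten-IsTup []       w a = []
    unflatten-IsTup (m ∷ ms) w a with V.splitAt m w
    ... | u , r , refl with ++⁻ u a
    ... | a1 , a2 = IsTup-toList a1 ∷ unflatten-IsTup ms r a2

    fromList-toList : ∀ {m} (u : Vec ℕ m) →
                      _≡_ {A = Σ ℕ (Vec ℕ)} (length (toList u) , fromList (toList u)) (m , u)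
    fromList-toList []      = refl
    fromList-toList (a ∷ u) = cong (λ { (n , v) → suc n , a ∷ v }) (fromList-toList u)

    flatten-unflatten : ∀ {k} (ms : Vec ℕ k) (w : Vec ℕ (total ms)) →
                        _≡_ {A = Σ (Vec ℕ k) (λ ns → Vec ℕ (total ns))}
                            (lens (unflatten ms w) , flatten (unflatten ms w)) (ms , w)
    flatten-unflatten []       []  = refl
    flatten-unflatten (m ∷ ms) w with V.splitAt m w
    ... | u , r , refl = cong₂ (λ { (n , v) (ns , v') → n ∷ ns , v ++ v' })
                               (fromList-toList u) (flatten-unflatten ms r)

  ∃Tuples-sat : ∀ k (P : Vec ℕ k → PForm) env →
                SatP (∃Tuples k P) env ↔
                (Σ (Vec (List ℕ) k) λ ys → All (IsTup B) ys × SatP (P (lens ys)) (env ++L toList (flatten ys)))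
  ∃Tuples-sat k P env = fw , bw
    where
      fw : _
      fw (c , w , aw , s) = unflatten (unpairVec k c) w , unflatten-IsTup (unpairVec k c) w aw ,
        subst (λ q → SatP (P (proj₁ q)) (env ++L toList (proj₂ q))) (sym (flatten-unflatten (unpairVec k c) w)) s
      bw : _
      bw (ys , ay , s) with unpairVec-onto (lens ys)
      ... | c , h = c , subst (λ ms → Σ (Vec ℕ (total ms)) λ w → All (dom B) w × SatP (P ms) (env ++L toList w))
                              (sym h) (flatten ys , All-flatten ay , s)

  Block : List ℕ → ℕ → List ℕ → Set
  Block env o l = Σ (List ℕ) λ pre → Σ (List ℕ) λ post → (env ≡ pre ++L (l ++L post)) × (length pre ≡ o)

  Block-At : ∀ {env o l j a} → Block env o l → At l j a → At env (o + j) a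
  Block-At (pre , post , refl , refl) x = At-++ʳ pre (At-++ˡ post x)

  Block-whole : ∀ env → Block env zero env
  Block-whole env = []L , []L , sym (++-identityʳ env) , refl

  Block-end : ∀ env l → Block (env ++L l) (length env) l
  Block-end env l = env , []L , cong (env ++L_) (sym (++-identityʳ l)) , refl

  Block-extend : ∀ {env o l} r → Block env o l → Block (env ++L r) o l
  Block-extend {l = l} r (pre , post , refl , e) =
    pre , post ++L r , trans (++-assoc pre (l ++L post) r) (cong (pre ++L_) (++-assoc l post r)) , e

  Block-split : ∀ {env o} l₁ l₂ → Block env o (l₁ ++L l₂) → Block env o l₁ × Block env (o + length l₁) l₂
  Block-split l₁ l₂ (pre , post , refl , refl) =
    (pre , l₂ ++L post , cong (pre ++L_) (++-assoc l₁ l₂ post) , refl) ,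
    (pre ++L l₁ , post ,
     trans (cong (pre ++L_) (++-assoc l₁ l₂ post)) (sym (++-assoc pre l₁ (l₂ ++L post))) ,
     length-++ pre)

  Block-flatten : ∀ {env o k} z (zs : Vec (List ℕ) k) → Block env o (toList (flatten (z ∷ zs))) →
                  Block env o z × Block env (o + length z) (toList (flatten zs))
  Block-flatten {env} {o} z zs blk
    with Block-split (toList (fromList z)) (toList (flatten zs))
                     (subst (Block _ _) (toList-++ (fromList z) (flatten zs)) blk)
  ... | b₁ , b₂ = subst (Block _ _) (toList∘fromList z) b₁ ,
                  subst (λ n → Block env n (toList (flatten zs))) (cong (o +_) (length-toList (fromList z))) b₂

  from : (o n : ℕ) → Fin n → ℕ
  from o n i = o + toℕ i

  _⊕_ : ∀ {a c} → (Fin a → ℕ) → (Fin c → ℕ) → Fin (a + c) → ℕ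
  _⊕_ {a} f g i = [ f , g ]′ (splitAt a i)
  infixr 5 _⊕_

  none : Fin zero → ℕ
  none ()

  Located-from : ∀ {env o n} {u : Vec ℕ n} → Block env o (toList u) → Located env (from o n) u
  Located-from {u = u} blk = located λ i → Block-At blk (At-toList u i)

  Located-fromList : ∀ {env o} {x : List ℕ} → Block env o x → Located env (from o (length x)) (fromList x)
  Located-fromList {x = x} blk = Located-from (subst (Block _ _) (sym (toList∘fromList x)) blk)

  Located-⊕ : ∀ {a c env} {f : Fin a → ℕ} {g : Fin c → ℕ} {u : Vec ℕ a} {v : Vec ℕ c} →
              Located env f u → Located env g v → Located env (f ⊕ g) (u ++ v)
  Located-⊕ {a} {env = env} {f} {g} {u} {v} lf lg = located cases
    where
      cases : ∀ i → At env ((f ⊕ g) i) (lookup (u ++ v) i)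
      cases i rewrite lookup-splitAt a u v i with splitAt a i
      ... | inj₁ x = places lf x
      ... | inj₂ y = places lg y

  Located-none : ∀ {env} → Located env none []
  Located-none = located λ ()

  fromFlat : ∀ {k} (ms : Vec ℕ k) → ℕ → Fin (total ms) → ℕ
  fromFlat []       o = none
  fromFlat (m ∷ ms) o = from o m ⊕ fromFlat ms (o + m)

  Located-flatten : ∀ {env o k} (ys : Vec (List ℕ) k) → Block env o (toList (flatten ys)) →
                    Located env (fromFlat (lens ys) o) (flatten ys)
  Located-flatten []       blk = Located-none
  Located-flatten (y ∷ ys) blk with Block-flatten y ys blk
  ... | b₁ , b₂ = Located-⊕ (Located-fromList b₁) (Located-flatten ys b₂)

module Invariance {L : Lang} (B : Str L) (G : ℕ → ℕ → Set)
                  (aut : IsIsoGraph (asPStr B) (asPStr B) G) where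
  open IsoGraph aut

  map-related : ∀ {n m} {e e' : Vec ℕ n} → Pointwise G e e' → (v : Vec (Fin n) m) →
                Pointwise G (map (lookup e) v) (map (lookup e') v)
  map-related pe []      = []
  map-related pe (i ∷ v) = PW.lookup pe i ∷ map-related pe v

  invariantQF : ∀ {n} {e e' : Vec ℕ n} → Pointwise G e e' → ∀ θ → SatQF B θ e ↔ SatQF B θ e'
  invariantQF pe tt = ↔-refl
  invariantQF pe ff = ↔-refl
  invariantQF {e = e} {e'} pe (eq i j) =
    (λ h → functional _ _ _ (subst (λ z → G z (lookup e' i)) h (PW.lookup pe i)) (PW.lookup pe j)) ,
    (λ h → injective _ _ _ (PW.lookup pe i) (subst (G (lookup e j)) (sym h) (PW.lookup pe j)))
  invariantQF pe (atom s v)  = preserves s _ _ (map-related pe v)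
  invariantQF pe (neg θ)     = ¬-cong (invariantQF pe θ)
  invariantQF pe (and θ θ')  = ×-cong (invariantQF pe θ) (invariantQF pe θ')
  invariantQF pe (or θ θ')   = ⊎-cong (invariantQF pe θ) (invariantQF pe θ')

  image : ∀ {m} {w : Vec ℕ m} → All (dom B) w → Σ (Vec ℕ m) λ w' → Pointwise G w w'
  image []      = [] , []
  image (d ∷ a) with defined _ d | image a
  ... | y , gy | w' , pw = y ∷ w' , gy ∷ pw

  preimage : ∀ {m} {w' : Vec ℕ m} → All (dom B) w' → Σ (Vec ℕ m) λ w → Pointwise G w w'
  preimage []      = [] , []
  preimage (d ∷ a) with surjective _ d | preimage a
  ... | y , gy | w , pw = y ∷ w , gy ∷ pw

  image-dom : ∀ {m n} {u : Vec ℕ m} {v : Vec ℕ n} → Pointwise G u v → All (dom B) v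
  image-dom []      = []
  image-dom (g ∷ p) = proj₂ (endpoints _ _ g) ∷ image-dom p

  preimage-dom : ∀ {m n} {u : Vec ℕ m} {v : Vec ℕ n} → Pointwise G u v → All (dom B) u
  preimage-dom []      = []
  preimage-dom (g ∷ p) = proj₁ (endpoints _ _ g) ∷ preimage-dom p

  -- witnesses of the existential block are moved by the automorphism
  invariantEx : ∀ {n} {e e' : Vec ℕ n} → Pointwise G e e' → ∀ φ → SatEx B φ e ↔ SatEx B φ e'
  invariantEx pe (ex m θ) =
    (λ { (w , aw , s) → let (w' , pw) = image aw in
                        w' , image-dom pw , proj₁ (invariantQF (PW.++⁺ pe pw) θ) s }) ,
    (λ { (w' , aw , s) → let (w , pw) = preimage aw in
                         w , preimage-dom pw , proj₂ (invariantQF (PW.++⁺ pe pw) θ) s })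

  invariantΣ₁ : ∀ {n} {e e' : Vec ℕ n} → Pointwise G e e' → ∀ Φ → SatΣ₁ B Φ e → SatΣ₁ B Φ e'
  invariantΣ₁ pe Φ (k , s) = k , proj₁ (invariantEx pe (Φ k)) s

  RelL : List ℕ → List ℕ → Set
  RelL x x' = Pointwise G (fromList x) (fromList x')

  transportList : ∀ x x' → RelL x x' → (Q : (n : ℕ) → Vec ℕ n → Set) →
                  (∀ v → Pointwise G (fromList x) v → Q (length x) v) → Q (length x') (fromList x')
  transportList []L       []L         []       Q h = h [] []
  transportList (a ∷L x) (a' ∷L x') (g ∷ pw) Q h =
    transportList x x' pw (λ n v → Q (suc n) (a' ∷ v)) (λ v pv → h (a' ∷ v) (g ∷ pv))

  transportTuples : ∀ {k} (xs xs' : Vec (List ℕ) k) → Pointwise RelL xs xs' →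
                    (P : (ns : Vec ℕ k) → Vec ℕ (total ns) → Set) →
                    (∀ v → Pointwise G (flatten xs) v → P (lens xs) v) → P (lens xs') (flatten xs')
  transportTuples []         []           []       P h = h [] []
  transportTuples (x ∷ xs) (x' ∷ xs') (r ∷ rs) P h =
    transportList x x' r (λ n u → P (n ∷ lens xs') (u ++ flatten xs'))
      (λ u pu → transportTuples xs xs' rs (λ ns v → P (length x ∷ ns) (u ++ v))
                                (λ v pv → h (u ++ v) (PW.++⁺ pu pv)))

  invariantGen : ∀ {p k} (Φ : GenΣ₁ L p k) {c c' : Vec ℕ p} {xs xs' : Vec (List ℕ) k} →
                 Pointwise G c c' → Pointwise RelL xs xs' → SatGen B Φ c xs → SatGen B Φ c' xs'
  invariantGen Φ {c} {c'} {xs} {xs'} pc rs s =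
    transportTuples xs xs' rs (λ ns v → SatΣ₁ B (Φ ns) (c' ++ v))
      (λ v pv → invariantΣ₁ (PW.++⁺ pc pv) (Φ (lens xs)) s)

  imageList : ∀ x → IsTup B x → Σ (List ℕ) λ x' → RelL x x'
  imageList []L       []       = []L , []
  imageList (a ∷L x) (d ∷ ax) with defined a d | imageList x ax
  ... | a' , g | x' , r = a' ∷L x' , g ∷ r

  imageTuples : ∀ {k} (xs : Vec (List ℕ) k) → All (IsTup B) xs →
                Σ (Vec (List ℕ) k) λ xs' → Pointwise RelL xs xs'
  imageTuples []         []         = [] , []
  imageTuples (x ∷ xs) (a ∷ as) with imageList x a | imageTuples xs as
  ... | x' , r | xs' , rs = x' ∷ xs' , r ∷ rs

  imageTuples-IsTup : ∀ {k} {xs xs' : Vec (List ℕ) k} → Pointwise RelL xs xs' → All (IsTup B) xs'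
  imageTuples-IsTup []       = []
  imageTuples-IsTup (r ∷ rs) = image-dom r ∷ imageTuples-IsTup rs

inverseAut : ∀ {L : Lang} (B : Str L) (G : ℕ → ℕ → Set) → IsIsoGraph (asPStr B) (asPStr B) G →
             IsIsoGraph (asPStr B) (asPStr B) (λ x y → G y x)
inverseAut B G (ends , def , fun , inj , surj , pres) =
  (λ x y h → proj₂ (ends _ _ h) , proj₁ (ends _ _ h)) , surj , (λ x y y' → inj _ _ _) ,
  (λ x x' y → fun _ _ _) , def ,
  (λ s xs ys pw → let pw' = PW.sym (λ g → g) pw in proj₂ (pres s ys xs pw') , proj₁ (pres s ys xs pw'))

module Construction
  (LA LB : Lang) (A : Str LA) (B : Str LB) (p : ℕ) (b : Vec ℕ p) (b-dom : All (dom B) b)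
  (F : DefForms LA LB p) (effDef : EffDefVia B F A b)
  (φ : Σ₁ LB p) (φ-orbit : DefinesΣ₁ B φ (InOrbit B b))
  (ψ : GenΣ₁ LB (p + p) 2)
  (f-iso : ∀ c d → InOrbit B b c → InOrbit B b d → IsIsoGraph (Ac B F c) (Ac B F d) (ψGraph B ψ c d))
  (f-id : ∀ c → InOrbit B b c → ∀ x y → ψGraph B ψ c c x y ↔ (Dc B F c x × x ≡ y))
  (f-comp : ∀ c d e → InOrbit B b c → InOrbit B b d → InOrbit B b e → ∀ x z →
            ψGraph B ψ c e x z ↔ (∃[ y ] (ψGraph B ψ c d x y × ψGraph B ψ d e y z)))
  where

  record Orbit (c : Vec ℕ p) : Set where
    constructor orbit
    field
      inDom : All (dom B) c
      sat   : SatΣ₁ B φ c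

  inOrbit : ∀ {c} → Orbit c → InOrbit B b c
  inOrbit {c} (orbit a s) = proj₁ (φ-orbit c a) s

  -- the identity automorphism witnesses that b̄ lies in its own orbit
  identityAut : IsIsoGraph (asPStr B) (asPStr B) (λ x y → dom B x × x ≡ y)
  identityAut = (λ { x .x (d , refl) → d , d }) , (λ x d → x , d , refl) ,
                (λ { x y y' (_ , refl) (_ , refl) → refl }) , (λ { x x' y (_ , refl) (_ , refl) → refl }) ,
                (λ y d → y , d , refl) ,
                (λ s xs ys pw → let eq = PW.Pointwise-≡⇒≡ (PW.map proj₂ pw) in
                                subst (rel B s) eq , subst (rel B s) (sym eq))

  b-orbit : Orbit b
  b-orbit = orbit b-dom (proj₂ (φ-orbit b b-dom) (_ , identityAut , reflexive b-dom))
    where reflexive : ∀ {n} {c : Vec ℕ n} → All (dom B) c → Pointwise (λ x y → dom B x × x ≡ y) c c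
          reflexive []      = []
          reflexive (d ∷ a) = (d , refl) ∷ reflexive a

  f : Vec ℕ p → Vec ℕ p → List ℕ → List ℕ → Set
  f = ψGraph B ψ

  module f {c d : Vec ℕ p} (oc : Orbit c) (od : Orbit d) =
    IsoGraph (f-iso c d (inOrbit oc) (inOrbit od))

  compose : ∀ {c d e} → Orbit c → Orbit d → Orbit e → ∀ x z →
            f c e x z ↔ (∃[ y ] (f c d x y × f d e y z))
  compose oc od oe = f-comp _ _ _ (inOrbit oc) (inOrbit od) (inOrbit oe)

  toA : List ℕ → ℕ → Set
  toA = proj₁ (proj₂ (proj₂ effDef))

  module toA = IsoGraph (proj₂ (proj₂ (proj₂ effDef)))

  Split : List ℕ → Vec ℕ p → List ℕ → Set
  Split z c x = z ≡ toList c ++L x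

  split-unique : ∀ {n} {c c' : Vec ℕ n} {x x'} → toList c ++L x ≡ toList c' ++L x' → c ≡ c' × x ≡ x'
  split-unique {c = []}    {[]}      e = refl , e
  split-unique {c = a ∷ c} {a' ∷ c'} e with ∷-injective e
  ... | refl , e' with split-unique {c = c} {c'} e'
  ... | refl , refl = refl , refl

  D : List ℕ → Set
  D z = Σ (Vec ℕ p) λ c → Σ (List ℕ) λ x → Split z c x × Orbit c × Dc B F c x

  Related : List ℕ → List ℕ → Set
  Related z z' = Σ (Vec ℕ p) λ c → Σ (List ℕ) λ x → Split z c x ×
                 (Σ (Vec ℕ p) λ d → Σ (List ℕ) λ y → Split z' d y × f c d x y)

  _∼_ : List ℕ → List ℕ → Set
  z ∼ z' = D z × D z' × Related z z'

  Represents : Vec ℕ p → List ℕ → List ℕ → Set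
  Represents c z y = Σ (Vec ℕ p) λ d → Σ (List ℕ) λ x → Split z d x × f d c x y

  H : List ℕ → ℕ → Set
  H z a = Σ (Vec ℕ p) λ c → Σ (List ℕ) λ x → Σ (List ℕ) λ u →
          Split z c x × Orbit c × f c b x u × toA u a

  -- the relations R* (and their complements) are defined uniformly from
  -- a formula Φ for a relation on each A_c̄: some c̄ in the orbit
  -- witnesses that the elements represented by z̄ satisfy Φ in A_c̄
  Witnessed : ∀ {k} → GenΣ₁ LB p k → Vec (List ℕ) k → Set
  Witnessed {k} Φ zs = All D zs × Σ (Vec ℕ p) λ c → Orbit c × Σ (Vec (List ℕ) k) λ ys →
                       All (IsTup B) ys × Pointwise (Represents c) zs ys × SatGen B Φ c ys

  R* : (s : Sym LA) → Vec (List ℕ) (ar LA s) → Set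
  R* s = Witnessed (φR F s)

  H-endpoints : ∀ z a → H z a → D z × dom A a
  H-endpoints z a (c , x , u , sp , oc , fu , gu) =
    (c , x , sp , oc , proj₁ (f.endpoints oc b-orbit x u fu)) , proj₂ (toA.endpoints u a gu)

  H-defined : ∀ z → D z → ∃[ a ] H z a
  H-defined z (c , x , sp , oc , dx) with f.defined oc b-orbit x dx
  ... | u , fu with toA.defined u (proj₂ (f.endpoints oc b-orbit x u fu))
  ... | a , gu = a , c , x , u , sp , oc , fu , gu

  H-functional : ∀ z a a' → H z a → H z a' → a ≡ a'
  H-functional z a a' (c , x , u , refl , oc , fu , gu) (c' , x' , u' , sp' , _ , fu' , gu')
    with split-unique {c = c} {c'} sp'
  ... | refl , refl with f.functional oc b-orbit x u u' fu fu'
  ... | refl = toA.functional u a a' gu gu'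

  -- every a ∈ A is hit by b̄⁀u where u ↦ a, since f_{b̄,b̄} is the identity
  H-onto : ∀ a → dom A a → ∃[ z ] H z a
  H-onto a da with toA.surjective a da
  ... | u , gu = toList b ++L u , b , u , u , refl , b-orbit ,
                 proj₂ (f-id b (inOrbit b-orbit) u u) (proj₁ (toA.endpoints u a gu) , refl) , gu

  -- ∼ is the kernel of H: by coherence, f_{c̄,b̄}(x̄) = f_{d̄,b̄}(f_{c̄,d̄}(x̄))
  H-kernel : ∀ z z' a a' → H z a → H z' a' → ((z ∼ z') ↔ (a ≡ a'))
  H-kernel z z' a a' hz@(c , x , u , refl , oc , fu , gu) hz'@(d , y , u' , refl , od , fu' , gu') =
    fw , bw
    where
      fw : z ∼ z' → a ≡ a'
      fw (_ , _ , c₂ , x₂ , sp , d₂ , y₂ , sp' , fxy)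
        with split-unique {c = c} {c₂} sp | split-unique {c = d} {d₂} sp'
      ... | refl , refl | refl , refl
        with f.functional oc b-orbit x u u' fu (proj₂ (compose oc od b-orbit x u') (y , fxy , fu'))
      ... | refl = toA.functional u a a' gu gu'
      bw : a ≡ a' → z ∼ z'
      bw refl with toA.injective u u' a gu gu'
      ... | refl with proj₁ (compose oc od b-orbit x u) fu
      ... | y' , fxy' , fy'u with f.injective od b-orbit y' y u fy'u fu'
      ... | refl = proj₁ (H-endpoints z a hz) , proj₁ (H-endpoints z' a hz') , c , x , refl , d , y , refl , fxy'

  -- if z represents y ∈ A_c̄, then H sends z to the image of y under
  -- A_c̄ ≅ A_b̄ ≅ A (again by coherence of f)
  represented-image : ∀ {c z y a} → Orbit c → Represents c z y → H z a →
                      Σ (List ℕ) λ u → f c b y u × toA u a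
  represented-image {c} oc (d , x , refl , fxy) (d' , x' , u , sp , od , fxu , gu)
    with split-unique {c = d} {d'} sp
  ... | refl , refl with proj₁ (compose od oc b-orbit x u) fxu
  ... | y' , fxy' , fy'u with f.functional od oc x _ _ fxy fxy'
  ... | refl = u , fy'u , gu

  represented-images : ∀ {c k} {zs ys : Vec (List ℕ) k} {as : Vec ℕ k} → Orbit c →
                       Pointwise (Represents c) zs ys → Pointwise H zs as →
                       Σ (Vec (List ℕ) k) λ us → Pointwise (f c b) ys us × Pointwise toA us as
  represented-images oc []         []         = [] , [] , []
  represented-images oc (r ∷ rs) (h ∷ hs) with represented-image oc r h | represented-images oc rs hs
  ... | u , fu , gu | us , fus , gus = u ∷ us , fu ∷ fus , gu ∷ gus

  H-represented : ∀ {k} {zs : Vec (List ℕ) k} {as : Vec ℕ k} → Pointwise H zs as →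
                  Σ (Vec (List ℕ) k) λ us → Pointwise (Represents b) zs us × Pointwise toA us as
  H-represented [] = [] , [] , []
  H-represented ((c , x , u , sp , oc , fu , gu) ∷ hs) with H-represented hs
  ... | us , rs , gs = u ∷ us , (c , x , sp , fu) ∷ rs , gu ∷ gs

  All-D : ∀ {k} {zs : Vec (List ℕ) k} {as : Vec ℕ k} → Pointwise H zs as → All D zs
  All-D []       = []
  All-D (h ∷ hs) = proj₁ (H-endpoints _ _ h) ∷ All-D hs

  All-H : ∀ {k} {zs : Vec (List ℕ) k} → All D zs → Σ (Vec ℕ k) λ as → Pointwise H zs as
  All-H []       = [] , []
  All-H (d ∷ ds) with H-defined _ d | All-H ds
  ... | a , h | as , hs = a ∷ as , h ∷ hs

  toA-domain : ∀ {k} {us : Vec (List ℕ) k} {as : Vec ℕ k} → Pointwise toA us as → All (Dc B F b) us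
  toA-domain []       = []
  toA-domain (g ∷ gs) = proj₁ (toA.endpoints _ _ g) ∷ toA-domain gs

  relation-transfer : ∀ s {c} {zs ys : Vec (List ℕ) (ar LA s)} {as} → Orbit c →
                      Pointwise (Represents c) zs ys → Pointwise H zs as → Rc B F c s ys ↔ rel A s as
  relation-transfer s oc rs hs with represented-images oc rs hs
  ... | us , fus , gus =
    (λ r → proj₁ (toA.preserves s us _ gus) (proj₁ (f.preserves oc b-orbit s _ us fus) r)) ,
    (λ r → proj₂ (f.preserves oc b-orbit s _ us fus) (proj₂ (toA.preserves s us _ gus) r))

  H-relations : ∀ s zs as → Pointwise H zs as → (R* s zs ↔ rel A s as)
  H-relations s zs as hs =
    (λ { (_ , c , oc , ys , tys , rs , sat) → proj₁ (relation-transfer s oc rs hs) (tys , sat) }) , bw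
    where
      bw : rel A s as → R* s zs
      bw r with H-represented hs
      ... | us , rs , _ with proj₂ (relation-transfer s b-orbit rs hs) r
      ... | tus , sat = All-D hs , b , b-orbit , us , tus , rs , sat

  H-quotientIso : IsQuotIsoGraph (record { pdom = D ; prel = R* }) _∼_ (asPStr A) H
  H-quotientIso = H-endpoints , H-defined , H-functional , H-onto , H-kernel , H-relations

  -- the complement of ∼ is existential: f_{c̄,d̄}(x̄) is some ȳ' ≠ ȳ
  NotRelated : List ℕ → List ℕ → Set
  NotRelated z z' = Σ (Vec ℕ p) λ c → Σ (List ℕ) λ x → Split z c x ×
                    (Σ (Vec ℕ p) λ d → Σ (List ℕ) λ y → Split z' d y ×
                      Σ (List ℕ) λ y' → f c d x y' × ¬ y' ≡ y)

  not-related : ∀ {z z'} → D z → D z' → NotRelated z z' ↔ (¬ Related z z')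
  not-related (c , x , refl , oc , dx) (d , y , refl , od , _) = fw , bw
    where
      fw : _
      fw (c₁ , x₁ , sp₁ , d₁ , y₁ , sp₁' , y' , fxy' , y'≢y) (c₂ , x₂ , sp₂ , d₂ , y₂ , sp₂' , fxy)
        with split-unique {c = c} {c₁} sp₁ | split-unique {c = d} {d₁} sp₁'
           | split-unique {c = c} {c₂} sp₂ | split-unique {c = d} {d₂} sp₂'
      ... | refl , refl | refl , refl | refl , refl | refl , refl = y'≢y (f.functional oc od x y' y fxy' fxy)
      bw : _
      bw unrelated with f.defined oc od x dx
      ... | y' , fxy' = c , x , refl , d , y , refl , y' , fxy' ,
                        (λ { refl → unrelated (c , x , refl , d , y' , refl , fxy') })

  module Moved (G : ℕ → ℕ → Set) (aut : IsIsoGraph (asPStr B) (asPStr B) G) where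
    open Invariance B G aut public

    moved-Dc : ∀ {c c' k} {ys ys' : Vec (List ℕ) k} → Pointwise G c c' → Pointwise RelL ys ys' →
               All (Dc B F c) ys → All (Dc B F c') ys'
    moved-Dc pc []       []              = []
    moved-Dc pc (r ∷ rs) ((_ , s) ∷ ds) = (image-dom r , invariantGen (φD F) pc (r ∷ []) s) ∷ moved-Dc pc rs ds

    moved-Rc : ∀ {c c'} s {ys ys' : Vec (List ℕ) (ar LA s)} → Pointwise G c c' → Pointwise RelL ys ys' →
               Rc B F c s ys → Rc B F c' s ys'
    moved-Rc s pc rs (_ , r) = imageTuples-IsTup rs , invariantGen (φR F s) pc rs r

  -- The formula for ¬R(b̄) also defines ¬R(c̄) with parameters c̄, for every
  -- c̄ in the orbit: transport along an automorphism taking b̄ to c̄.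
  negation-in-orbit : ∀ s {c} ys → Orbit c → All (IsTup B) ys →
                      SatGen B (φnR F s) c ys ↔ (All (Dc B F c) ys × ¬ Rc B F c s ys)
  negation-in-orbit s {c} ys oc tys with inOrbit oc
  ... | G , aut , pbc = fw , bw
    where
      module To   = Moved G aut
      module Back = Moved (λ x y → G y x) (inverseAut B G aut)
      pcb = PW.sym (λ g → g) pbc
      ys' = proj₁ (Back.imageTuples ys tys)
      back : Pointwise Back.RelL ys ys'
      back = proj₂ (Back.imageTuples ys tys)
      to : Pointwise To.RelL ys' ys
      to = PW.sym (PW.sym (λ g → g)) back
      at-b = proj₁ (proj₂ effDef) s ys' (Back.imageTuples-IsTup back)
      fw : _
      fw sat with proj₁ at-b (Back.invariantGen (φnR F s) pcb back sat)
      ... | dcb , nrb = To.moved-Dc pbc to dcb , (λ rc → nrb (Back.moved-Rc s pcb back rc))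
      bw : _
      bw (dcc , nrc) = To.invariantGen (φnR F s) pbc to
        (proj₂ at-b (Back.moved-Dc pcb back dcc , (λ rb → nrc (To.moved-Rc s pbc to rb))))

  nonWitnessed : ∀ s zs → Witnessed (φnR F s) zs ↔ (All D zs × ¬ R* s zs)
  nonWitnessed s zs = fw , bw
    where
      fw : _
      fw (ad , c , oc , ys , tys , rs , sat) with All-H ad | proj₁ (negation-in-orbit s ys oc tys) sat
      ... | as , hs | _ , nrc =
        ad , (λ r → nrc (proj₂ (relation-transfer s oc rs hs) (proj₁ (H-relations s zs as hs) r)))
      bw : _
      bw (ad , nr) with All-H ad
      ... | as , hs with H-represented hs
      ... | us , rs , gs = ad , b , b-orbit , us , tus , rs ,
              proj₂ (negation-in-orbit s us b-orbit tus)
                (toA-domain gs , (λ rb → nr (proj₂ (H-relations s zs as hs) (proj₁ (relation-transfer s b-orbit rs hs) rb))))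
        where tus = All.map proj₁ (toA-domain gs)

  -- A tuple z̄ is read as c̄⁀x̄ by splitting off its
  -- first p entries; the orbit condition replaces the parameters.
  module Definitions where
    open Positional B

    split-prefix : ∀ n z → n ≤ length z → Σ (Vec ℕ n) λ c → Σ (List ℕ) λ x → z ≡ toList c ++L x
    split-prefix zero    z         h       = [] , z , refl
    split-prefix (suc n) (a ∷L z) (s≤s h) with split-prefix n z h
    ... | c , x , e = a ∷ c , x , cong (a ∷L_) e

    split-length : ∀ {z} {c : Vec ℕ p} {x} → Split z c x → length z ≡ p + length x
    split-length {c = c} {x} refl = trans (length-++ (toList c)) (cong (_+ length x) (length-toList c))

    IsTup-split : ∀ {n} (c : Vec ℕ n) x → IsTup B (toList c ++L x) → All (dom B) c × IsTup B x
    IsTup-split []      x a       = [] , a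
    IsTup-split (_ ∷ c) x (d ∷ a) with IsTup-split c x a
    ... | a₁ , a₂ = d ∷ a₁ , a₂

    IsTup-join : ∀ {n} (c : Vec ℕ n) x → All (dom B) c → IsTup B x → IsTup B (toList c ++L x)
    IsTup-join []      x []      t = t
    IsTup-join (_ ∷ c) x (d ∷ a) t = d ∷ IsTup-join c x a t

    D-tuples : ∀ z → D z → IsTup B z
    D-tuples z (c , x , refl , orbit ac _ , (tx , _)) = IsTup-join c x ac tx

    Block-Split : ∀ {env o z} {c : Vec ℕ p} {x} → Block env o z → Split z c x →
                  Block env o (toList c) × Block env (o + p) x
    Block-Split {env} {o} {c = c} {x} blk refl with Block-split (toList c) x blk
    ... | b₁ , b₂ = b₁ , subst (λ n → Block env n x) (cong (o +_) (length-toList c)) b₂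

    WithSplit : ℕ → (ℕ → PForm) → PForm
    WithSplit N P with p ≤? N
    ... | yes _ = P (N ∸ p)
    ... | no _  = falseP

    WithSplit-sat : ∀ {env} z (P : ℕ → PForm) (Q : Vec ℕ p → List ℕ → Set) →
                    (∀ c x → Split z c x → SatP (P (length x)) env ↔ Q c x) →
                    SatP (WithSplit (length z) P) env ↔
                    (Σ (Vec ℕ p) λ c → Σ (List ℕ) λ x → Split z c x × Q c x)
    WithSplit-sat {env} z P Q hyp with p ≤? length z
    ... | yes h = fw , bw
      where
        c = proj₁ (split-prefix p z h)
        x = proj₁ (proj₂ (split-prefix p z h))
        sp = proj₂ (proj₂ (split-prefix p z h))
        len : length z ∸ p ≡ length x
        len = trans (cong (_∸ p) (split-length {c = c} sp)) (m+n∸m≡n p (length x))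
        fw : _
        fw s = c , x , sp , proj₁ (hyp c x sp) (subst (λ n → SatP (P n) env) len s)
        bw : _
        bw (c' , x' , sp' , q) with split-unique {c = c} {c'} (trans (sym sp) sp')
        ... | refl , refl = subst (λ n → SatP (P n) env) (sym len) (proj₂ (hyp c x sp) q)
    ... | no nh = (λ s → ⊥-elim (falseP-unsat s)) ,
                  (λ { (c , x , sp , _) → ⊥-elim (nh (subst (p ≤_) (sym (split-length {c = c} sp)) (m≤m+n p (length x)))) })

    OrbitAt : ℕ → PForm
    OrbitAt oc = emb p (from oc p) φ

    OrbitAt-sat : ∀ {env oc} {c : Vec ℕ p} → Block env oc (toList c) → All (dom B) c →
                  SatP (OrbitAt oc) env ↔ Orbit c
    OrbitAt-sat blk ac = (λ s → orbit ac (proj₁ (emb-sat φ (Located-from blk)) s)) ,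
                         (λ oc → proj₂ (emb-sat φ (Located-from blk)) (Orbit.sat oc))

    GenAt : ∀ {k} → GenΣ₁ LB p k → ℕ → Vec ℕ k → PForm
    GenAt Φ oc ms = emb (p + total ms) (from oc p ⊕ fromFlat ms (oc + p)) (Φ ms)

    GenAt-sat : ∀ {env oc k} (Φ : GenΣ₁ LB p k) {c : Vec ℕ p} (ys : Vec (List ℕ) k) →
                Block env oc (toList c) → Block env (oc + p) (toList (flatten ys)) →
                SatP (GenAt Φ oc (lens ys)) env ↔ SatGen B Φ c ys
    GenAt-sat Φ {c} ys bc bys = emb-sat (Φ (lens ys)) (Located-⊕ (Located-from bc) (Located-flatten ys bys))

    DAt : ℕ → ℕ → PForm
    DAt o N = WithSplit N (λ n → OrbitAt o ∧ₚ GenAt (φD F) o (n ∷ []))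

    DAt-sat : ∀ {env o} z → Block env o z → IsTup B z → SatP (DAt o (length z)) env ↔ D z
    DAt-sat {env} {o} z blk tz = WithSplit-sat z _ (λ c x → Orbit c × Dc B F c x) parts
      where
        parts : ∀ c x → Split z c x → _
        parts c x sp with Block-Split {c = c} blk sp | IsTup-split c x (subst (IsTup B) sp tz)
        ... | bc , bx | ac , tx =
          ×-cong (OrbitAt-sat bc ac) ((λ s → tx , proj₁ GenD s) , (λ d → proj₂ GenD (proj₂ d)))
          where
            single : toList (flatten (x ∷ [])) ≡ x
            single = trans (toList-++ (fromList x) []) (trans (++-identityʳ _) (toList∘fromList x))
            GenD = GenAt-sat (φD F) (x ∷ []) bc (subst (Block env (o + p)) (sym single) bx)

    fAt : (oc od ox nx oy ny : ℕ) → PForm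
    fAt oc od ox nx oy ny =
      emb ((p + p) + (nx + (ny + zero))) ((from oc p ⊕ from od p) ⊕ (from ox nx ⊕ (from oy ny ⊕ none))) (ψ (nx ∷ ny ∷ []))

    fAt-sat : ∀ {env oc od ox oy} {c d : Vec ℕ p} {x y} →
              Block env oc (toList c) → Block env od (toList d) → Block env ox x → Block env oy y →
              IsTup B x → IsTup B y →
              SatP (fAt oc od ox (length x) oy (length y)) env ↔ f c d x y
    fAt-sat {c = c} {d} {x} {y} bc bd bx by tx ty =
      (λ s → tx , ty , proj₁ sat s) , (λ { (_ , _ , s) → proj₂ sat s })
      where
        sat = emb-sat (ψ (length x ∷ length y ∷ []))
                (Located-⊕ (Located-⊕ (Located-from bc) (Located-from bd))
                  (Located-⊕ (Located-fromList bx) (Located-⊕ (Located-fromList by) Located-none)))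

    pairBlocks : ∀ z z' → Block (toList (flatten (z ∷ z' ∷ []))) zero z ×
                          Block (toList (flatten (z ∷ z' ∷ []))) (length z) z'
    pairBlocks z z' with Block-flatten z (z' ∷ []) (Block-whole _)
    ... | b₁ , rest = b₁ , proj₁ (Block-flatten z' [] rest)

    SimAt : ℕ → ℕ → PForm
    SimAt N N' = DAt zero N ∧ₚ (DAt N N' ∧ₚ
                 WithSplit N (λ n → WithSplit N' (λ n' → fAt zero N p n (N + p) n')))

    SimAt-sat : ∀ z z' → IsTup B z → IsTup B z' →
                SatP (SimAt (length z) (length z')) (toList (flatten (z ∷ z' ∷ []))) ↔ (D z × D z' × Related z z')
    SimAt-sat z z' tz tz' = ×-cong (DAt-sat z b₁ tz) (×-cong (DAt-sat z' b₂ tz') related)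
      where
        b₁ = proj₁ (pairBlocks z z')
        b₂ = proj₂ (pairBlocks z z')
        inner : ∀ c x → Split z c x → ∀ d y → Split z' d y → _
        inner c x sp d y sp' with Block-Split {c = c} b₁ sp | Block-Split {c = d} b₂ sp'
        ... | bc , bx | bd , by =
          fAt-sat bc bd bx by (proj₂ (IsTup-split c x (subst (IsTup B) sp tz)))
                              (proj₂ (IsTup-split d y (subst (IsTup B) sp' tz')))
        related = WithSplit-sat z _ _ (λ c x sp → WithSplit-sat z' _ (λ d y → f c d x y) (inner c x sp))

    first-difference : ∀ x y → length x ≡ length y → ¬ x ≡ y →
                       Σ ℕ λ i → Σ ℕ λ a → Σ ℕ λ c → At x i a × At y i c × ¬ a ≡ c
    first-difference []L       []L       e ne = ⊥-elim (ne refl)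
    first-difference (a ∷L x) (c ∷L y) e ne with a ℕ.≟ c
    ... | no h = zero , a , c , here , here , h
    ... | yes refl with first-difference x y (suc-injective e) (λ q → ne (cong (a ∷L_) q))
    ... | i , a' , c' , l₁ , l₂ , h = suc i , a' , c' , there l₁ , there l₂ , h

    DiffAt : ℕ → ℕ → ℕ → ℕ → PForm
    DiffAt oa na ob i with i <? na
    ... | yes _ = emb 2 (λ { fz → oa + i ; (fs fz) → ob + i }) (λ _ → ex zero (neg (eq fz (fs fz))))
    ... | no _  = falseP

    NeqAt : ℕ → ℕ → ℕ → ℕ → PForm
    NeqAt oa na ob nb with na ℕ.≟ nb
    ... | yes _ = ⋁ₚ (DiffAt oa na ob)
    ... | no _  = trueP

    DiffAt-sound : ∀ {env oa ob x y} i → Block env oa x → Block env ob y →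
                   SatP (DiffAt oa (length x) ob i) env → ¬ x ≡ y
    DiffAt-sound {x = x} i bx by s with i <? length x
    ... | no _ = ⊥-elim (falseP-unsat s)
    DiffAt-sound {x = x} i bx by ((a ∷ c ∷ []) , located loc , _ , [] , _ , a≢c) | yes h =
      λ { refl → a≢c (trans (At-functional (loc fz) (Block-At bx xi)) (At-functional (Block-At by xi) (loc (fs fz)))) }
      where xi = proj₂ (At-exists x i h)

    DiffAt-complete : ∀ {env oa ob x y i a c} → Block env oa x → Block env ob y →
                      At x i a → At y i c → ¬ a ≡ c → SatP (DiffAt oa (length x) ob i) env
    DiffAt-complete {x = x} {i = i} {a} {c} bx by xi yi a≢c with i <? length x
    ... | no nh = ⊥-elim (nh (At-bound xi))
    ... | yes h = (a ∷ c ∷ []) , located (λ { fz → Block-At bx xi ; (fs fz) → Block-At by yi }) ,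
                  zero , [] , [] , a≢c

    NeqAt-sat : ∀ {env oa ob} x y → Block env oa x → Block env ob y →
                SatP (NeqAt oa (length x) ob (length y)) env ↔ (¬ x ≡ y)
    NeqAt-sat x y bx by with length x ℕ.≟ length y
    ... | yes same = (λ { (i , s) → DiffAt-sound i bx by s }) ,
                     (λ ne → let (i , a , c , xi , yi , a≢c) = first-difference x y same ne
                             in i , DiffAt-complete bx by xi yi a≢c)
    ... | no diff  = (λ _ e → diff (cong length e)) , (λ _ → trueP-sat)

    NotSimAt : ℕ → ℕ → PForm
    NotSimAt N N' = DAt zero N ∧ₚ (DAt N N' ∧ₚ WithSplit N (λ n → WithSplit N' (λ n' →
      ∃Tuples 1 (λ ms → fAt zero N p n T (V.head ms) ∧ₚ NeqAt (N + p) n' T (V.head ms)))))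
      where T = N + (N' + zero)

    NotSimAt-sat : ∀ z z' → IsTup B z → IsTup B z' →
                   SatP (NotSimAt (length z) (length z')) (toList (flatten (z ∷ z' ∷ []))) ↔
                   (D z × D z' × NotRelated z z')
    NotSimAt-sat z z' tz tz' = ×-cong (DAt-sat z b₁ tz) (×-cong (DAt-sat z' b₂ tz') notRelated)
      where
        env = toList (flatten (z ∷ z' ∷ []))
        T = length z + (length z' + zero)
        b₁ = proj₁ (pairBlocks z z')
        b₂ = proj₂ (pairBlocks z z')
        by' : ∀ y' → Block (env ++L toList (flatten (y' ∷ []))) T y'
        by' y' = proj₁ (Block-flatten y' []
                   (subst (λ n → Block (env ++L toList (flatten (y' ∷ []))) n (toList (flatten (y' ∷ []))))
                          (length-toList (flatten (z ∷ z' ∷ []))) (Block-end env _)))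
        inner : ∀ c x → Split z c x → ∀ d y → Split z' d y → _
        inner c x sp d y sp'
          with Block-Split {c = c} b₁ sp | Block-Split {c = d} b₂ sp'
             | IsTup-split c x (subst (IsTup B) sp tz) | IsTup-split d y (subst (IsTup B) sp' tz')
        ... | bc , bx | bd , by | _ , tx | _ , ty = fw , bw
          where
            ∃y' = ∃Tuples-sat 1 (λ ms → fAt zero (length z) p (length x) T (V.head ms) ∧ₚ
                                         NeqAt (length z + p) (length y) T (V.head ms)) env
            fAt' = λ y' ty' → fAt-sat (Block-extend _ bc) (Block-extend _ bd) (Block-extend _ bx) (by' y') tx ty'
            neq = λ y' → NeqAt-sat y y' (Block-extend _ by) (by' y')
            fw : _ → Σ (List ℕ) λ y' → f c d x y' × ¬ y' ≡ y
            fw s with proj₁ ∃y' s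
            ... | (y' ∷ []) , (ty' ∷ []) , s₁ , s₂ =
              y' , proj₁ (fAt' y' ty') s₁ , (λ e → proj₁ (neq y') s₂ (sym e))
            bw : _
            bw (y' , fxy'@(_ , ty' , _) , y'≢y) =
              proj₂ ∃y' ((y' ∷ []) , (ty' ∷ []) , proj₂ (fAt' y' ty') fxy' , proj₂ (neq y') (λ e → y'≢y (sym e)))
        notRelated = WithSplit-sat z _ _ (λ c x sp → WithSplit-sat z' _ _ (inner c x sp))

    AllDAt : ∀ {k} → Vec ℕ k → ℕ → PForm
    AllDAt []       o = trueP
    AllDAt (n ∷ ns) o = DAt o n ∧ₚ AllDAt ns (o + n)

    AllDAt-sat : ∀ {env o k} (zs : Vec (List ℕ) k) → Block env o (toList (flatten zs)) → All (IsTup B) zs →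
                 SatP (AllDAt (lens zs) o) env ↔ All D zs
    AllDAt-sat []       _   _          = (λ _ → []) , (λ _ → trueP-sat)
    AllDAt-sat (z ∷ zs) blk (tz ∷ tzs) with Block-flatten z zs blk
    ... | b₁ , b₂ = (λ { (d , ds) → proj₁ (DAt-sat z b₁ tz) d ∷ proj₁ (AllDAt-sat zs b₂ tzs) ds }) ,
                    (λ { (d ∷ ds) → proj₂ (DAt-sat z b₁ tz) d , proj₂ (AllDAt-sat zs b₂ tzs) ds })

    RepresentsAt : ℕ → ℕ → ℕ → ℕ → ℕ → PForm
    RepresentsAt oz N oc oy m = WithSplit N (λ n → fAt oz oc (oz + p) n oy m)

    RepresentsAt-sat : ∀ {env oz oc oy} {c : Vec ℕ p} z y → Block env oz z → Block env oc (toList c) →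
                       Block env oy y → IsTup B z → IsTup B y →
                       SatP (RepresentsAt oz (length z) oc oy (length y)) env ↔ Represents c z y
    RepresentsAt-sat z y bz bc by tz ty = WithSplit-sat z _ _ parts
      where
        parts : ∀ d x → Split z d x → _
        parts d x sp with Block-Split {c = d} bz sp | IsTup-split d x (subst (IsTup B) sp tz)
        ... | bd , bx | _ , tx = fAt-sat bd bc bx by tx ty

    AllRepresentAt : ∀ {k} → Vec ℕ k → Vec ℕ k → ℕ → ℕ → ℕ → PForm
    AllRepresentAt []       []       oz oc oy = trueP
    AllRepresentAt (n ∷ ns) (m ∷ ms) oz oc oy =
      RepresentsAt oz n oc oy m ∧ₚ AllRepresentAt ns ms (oz + n) oc (oy + m)

    AllRepresentAt-sat : ∀ {env oz oc oy k} {c : Vec ℕ p} (zs ys : Vec (List ℕ) k) →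
                         Block env oz (toList (flatten zs)) → Block env oc (toList c) →
                         Block env oy (toList (flatten ys)) → All (IsTup B) zs → All (IsTup B) ys →
                         SatP (AllRepresentAt (lens zs) (lens ys) oz oc oy) env ↔ Pointwise (Represents c) zs ys
    AllRepresentAt-sat []       []       _  _  _  _          _          = (λ _ → []) , (λ _ → trueP-sat)
    AllRepresentAt-sat (z ∷ zs) (y ∷ ys) bz bc by (tz ∷ tzs) (ty ∷ tys)
      with Block-flatten z zs bz | Block-flatten y ys by
    ... | bz₁ , bz₂ | by₁ , by₂ =
      (λ { (r , rs) → proj₁ head r ∷ proj₁ tail rs }) , (λ { (r ∷ rs) → proj₂ head r , proj₂ tail rs })
      where
        head = RepresentsAt-sat z y bz₁ bc by₁ tz ty
        tail = AllRepresentAt-sat zs ys bz₂ bc by₂ tzs tys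

    WitnessedAt : ∀ {k} → GenΣ₁ LB p k → Vec ℕ k → PForm
    WitnessedAt {k} Φ ns = AllDAt ns zero ∧ₚ ∃ₚ p (OrbitAt T ∧ₚ
      ∃Tuples k (λ ms → AllRepresentAt ns ms zero T (T + p) ∧ₚ GenAt Φ T ms))
      where T = total ns

    WitnessedAt-sat : ∀ {k} (Φ : GenΣ₁ LB p k) (zs : Vec (List ℕ) k) → All (IsTup B) zs →
                      SatP (WitnessedAt Φ (lens zs)) (toList (flatten zs)) ↔ Witnessed Φ zs
    WitnessedAt-sat {k} Φ zs tzs = fw , bw
      where
        T = total (lens zs)
        env = toList (flatten zs)
        allD = AllDAt-sat zs (Block-whole env) tzs
        bc : ∀ (c : Vec ℕ p) → Block (env ++L toList c) T (toList c)
        bc c = subst (λ n → Block (env ++L toList c) n (toList c)) (length-toList (flatten zs)) (Block-end env (toList c))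
        by : ∀ (c : Vec ℕ p) ys → Block ((env ++L toList c) ++L toList (flatten ys)) (T + p) (toList (flatten ys))
        by c ys = subst (λ n → Block ((env ++L toList c) ++L toList (flatten ys)) n (toList (flatten ys)))
                        (trans (length-++ env) (cong₂ _+_ (length-toList (flatten zs)) (length-toList c)))
                        (Block-end (env ++L toList c) (toList (flatten ys)))
        ∃ys = λ c → ∃Tuples-sat k (λ ms → AllRepresentAt (lens zs) ms zero T (T + p) ∧ₚ GenAt Φ T ms) (env ++L toList c)
        body : ∀ c ys → All (IsTup B) ys →
               SatP (AllRepresentAt (lens zs) (lens ys) zero T (T + p) ∧ₚ GenAt Φ T (lens ys))
                    ((env ++L toList c) ++L toList (flatten ys))
               ↔ (Pointwise (Represents c) zs ys × SatGen B Φ c ys)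
        body c ys tys = ×-cong
          (AllRepresentAt-sat zs ys (Block-extend _ (Block-extend _ (Block-whole env))) (Block-extend _ (bc c)) (by c ys) tzs tys)
          (GenAt-sat Φ ys (Block-extend _ (bc c)) (by c ys))
        fw : _
        fw (sd , c , ac , so , s) with proj₁ (∃ys c) s
        ... | ys , tys , r = proj₁ allD sd , c , proj₁ (OrbitAt-sat (bc c) ac) so , ys , tys , proj₁ (body c ys tys) r
        bw : _
        bw (ad , c , oc , ys , tys , rs , sat) =
          proj₂ allD ad , c , Orbit.inDom oc , proj₂ (OrbitAt-sat (bc c) (Orbit.inDom oc)) oc ,
          proj₂ (∃ys c) (ys , tys , proj₂ (body c ys tys) (rs , sat))

    compileGen : ∀ {k} → (Vec ℕ k → PForm) → GenΣ₁ LB zero k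
    compileGen P ns = compile (total ns) (P ns)

    compileGen-defines : ∀ {k} (P : Vec ℕ k → PForm) (S : Vec (List ℕ) k → Set) →
                         (∀ zs → All (IsTup B) zs → SatP (P (lens zs)) (toList (flatten zs)) ↔ S zs) →
                         DefinesGen B (compileGen P) [] S
    compileGen-defines P S sat zs tzs = ↔-trans (compile-sat _ (P (lens zs)) (flatten zs)) (sat zs tzs)

    ψD : GenΣ₁ LB zero 1
    ψD = compileGen (λ ns → DAt zero (V.head ns))

    ψ∼ ψ≁ : GenΣ₁ LB zero 2
    ψ∼ = compileGen (λ ns → SimAt (V.head ns) (V.head (V.tail ns)))
    ψ≁ = compileGen (λ ns → NotSimAt (V.head ns) (V.head (V.tail ns)))

    ψR ψnR : (s : Sym LA) → GenΣ₁ LB zero (ar LA s)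
    ψR s  = compileGen (WitnessedAt (φR F s))
    ψnR s = compileGen (WitnessedAt (φnR F s))

    D-defined : DefinesGen B ψD [] (λ zs → D (V.head zs))
    D-defined = compileGen-defines (λ ns → DAt zero (V.head ns)) _ λ { (z ∷ []) (tz ∷ []) →
      DAt-sat z (proj₁ (Block-flatten z [] (Block-whole _))) tz }

    ∼-defined : DefinesGen B ψ∼ [] (λ zs → D (V.head zs) × D (V.head (V.tail zs)) × (V.head zs ∼ V.head (V.tail zs)))
    ∼-defined = compileGen-defines (λ ns → SimAt (V.head ns) (V.head (V.tail ns))) _ λ { (z ∷ z' ∷ []) (tz ∷ tz' ∷ []) →
      ↔-trans (SimAt-sat z z' tz tz')
              ((λ { (d , d' , r) → d , d' , d , d' , r }) , (λ { (d , d' , _ , _ , r) → d , d' , r })) }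

    ≁-defined : DefinesGen B ψ≁ [] (λ zs → D (V.head zs) × D (V.head (V.tail zs)) × ¬ (V.head zs ∼ V.head (V.tail zs)))
    ≁-defined = compileGen-defines (λ ns → NotSimAt (V.head ns) (V.head (V.tail ns))) _ λ { (z ∷ z' ∷ []) (tz ∷ tz' ∷ []) →
      ↔-trans (NotSimAt-sat z z' tz tz')
              ((λ { (d , d' , nr) → d , d' , (λ { (_ , _ , r) → proj₁ (not-related d d') nr r }) }) ,
               (λ { (d , d' , n∼) → d , d' , proj₂ (not-related d d') (λ r → n∼ (d , d' , r)) })) }

    R*-defined : ∀ s → DefinesGen B (ψR s) [] (λ zs → All D zs × R* s zs)
    R*-defined s = compileGen-defines (WitnessedAt (φR F s)) _ λ zs tzs →
      ↔-trans (WitnessedAt-sat (φR F s) zs tzs) ((λ w → proj₁ w , w) , proj₂)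

    ¬R*-defined : ∀ s → DefinesGen B (ψnR s) [] (λ zs → All D zs × ¬ R* s zs)
    ¬R*-defined s = compileGen-defines (WitnessedAt (φnR F s)) _ λ zs tzs →
      ↔-trans (WitnessedAt-sat (φnR F s) zs tzs) (nonWitnessed s zs)

proposition6p2 : (LA LB : Lang) (A : Str LA) (B : Str LB) (p : ℕ) (b : Vec ℕ p) →
    All (dom B) b →
    (F : DefForms LA LB p) →
    EffDefVia B F A b →
    (φ : Σ₁ LB p) →
    DefinesΣ₁ B φ (InOrbit B b) →
    (ψ : GenΣ₁ LB (p + p) 2) →
    (∀ c d → InOrbit B b c → InOrbit B b d →
       IsIsoGraph (Ac B F c) (Ac B F d) (ψGraph B ψ c d)) →
    (∀ c → InOrbit B b c → ∀ x y →
       ψGraph B ψ c c x y ↔ (Dc B F c x × x ≡ y)) →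
    (∀ c d e → InOrbit B b c → InOrbit B b d → InOrbit B b e → ∀ x z →
       ψGraph B ψ c e x z ↔ (∃[ y ] (ψGraph B ψ c d x y × ψGraph B ψ d e y z))) →
    EffInterpreted A B
proposition6p2 LA LB A B p b b-dom F effDef φ φ-orbit ψ f-iso f-id f-comp =
  ψD , ψ∼ , ψ≁ , ψR , ψnR , D , _∼_ , R* ,
  D-tuples , (λ z z' → λ { (d , d' , _) → d , d' }) , (λ s zs → proj₁) ,
  D-defined , ∼-defined , ≁-defined , R*-defined , ¬R*-defined ,
  (H , H-quotientIso)
  where
    open Construction LA LB A B p b b-dom F effDef φ φ-orbit ψ f-iso f-id f-comp
    open Definitions
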